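{- For every integer $k \geq 3$, $$AR_d(C_k) \leq \begin{cases} 2(k-1) & \text{if } k \text{ is even},\\ 2(k+2) & \text{if } k \text{ is odd.}\end{cases}$$
   Context: $C_k$ denotes the cycle on $k$ vertices. A proper edge colouring assigns colours to edges so that edges sharing a vertex receive distinct colours. A copy of $H$ in an edge-coloured graph is rainbow if all its edges have distinct colours. The degree anti-Ramsey number $AR_d(H)$ is the smallest integer $m$ for which there exists a (finite, simple) graph $G$ with maximum degree at most $m$ such that every proper edge colouring of $G$ contains a rainbow copy of $H$. -}

module Defs where

open import Data.Nat using (ℕ; zero; suc; _+_; _*_; _≤_; _≥_)
open import Data.Nat.Properties using ()
open import Data.Fin using (Fin; toℕ; fromℕ<)
open import Data.Fin.Subset using (Subset; ∣_∣)
open import Data.Vec using (tabulate)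
open import Data.Bool using (Bool; true; false)
open import Data.Product using (Σ; ∃; _×_; _,_)
open import Data.Empty using (⊥)
open import Relation.Nullary using (¬_; Dec; does)
open import Relation.Binary.PropositionalEquality using (_≡_)
open import Function.Definitions using (Injective)
open import Data.Nat.DivMod using (_%_; m%n<n)
open import Data.Nat using (NonZero)

record Graph (n : ℕ) : Set₁ where
  field
    Adj     : Fin n → Fin n → Set
    adj?    : (u v : Fin n) → Dec (Adj u v)
    sym     : ∀ {u v} → Adj u v → Adj v u
    irrefl  : ∀ {u} → ¬ Adj u u
open Graph public

nbhd : ∀ {n} → Graph n → Fin n → Subset n
nbhd G v = tabulate (λ u → does (adj? G v u))

degree : ∀ {n} → Graph n → Fin n → ℕ
degree G v = ∣ nbhd G v ∣

MaxDegreeAtMost : ∀ {n} → Graph n → ℕ → Set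
MaxDegreeAtMost G m = ∀ v → degree G v ≤ m

-- An edge colouring with colours in ℕ: a colour assigned to each ordered
-- pair, required symmetric on edges (so it is a function of the edge {u,v}).
-- Values on non-edges are irrelevant.
record EdgeColouring {n : ℕ} (G : Graph n) : Set where
  field
    col    : Fin n → Fin n → ℕ
    col-sym : ∀ {u v} → Adj G u v → col u v ≡ col v u
open EdgeColouring public

Proper : ∀ {n} {G : Graph n} → EdgeColouring G → Set
Proper {n} {G} c = ∀ u v w → Adj G u v → Adj G u w → ¬ (v ≡ w) →
  ¬ (col c u v ≡ col c u w)

next : ∀ {k} .{{_ : NonZero k}} → Fin k → Fin k
next {k} i = fromℕ< (m%n<n (suc (toℕ i)) k)

record CycleCopy {n : ℕ} (G : Graph n) (k : ℕ) .{{_ : NonZero k}} : Set where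
  field
    vert  : Fin k → Fin n
    inj   : Injective _≡_ _≡_ vert
    edge  : ∀ i → Adj G (vert i) (vert (next i))
open CycleCopy public

Rainbow : ∀ {n} {G : Graph n} {k} .{{_ : NonZero k}} →
  EdgeColouring G → CycleCopy G k → Set
Rainbow c C = ∀ i j → col c (vert C i) (vert C (next i)) ≡ col c (vert C j) (vert C (next j)) → i ≡ j

ForcesRainbowCycle : ∀ {n} → Graph n → (k : ℕ) .{{_ : NonZero k}} → Set
ForcesRainbowCycle G k = (c : EdgeColouring G) → Proper c →
  Σ (CycleCopy G k) (λ C → Rainbow c C)

AdmissibleARd : (k : ℕ) .{{_ : NonZero k}} → ℕ → Set₁
AdmissibleARd k m = Σ ℕ (λ n → Σ (Graph n) (λ G → MaxDegreeAtMost G m × ForcesRainbowCycle G k))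

-- AR_d(C_k) ≤ b : the smallest admissible m is ≤ b, i.e. some admissible m ≤ b.
ARd-≤ : (k : ℕ) .{{_ : NonZero k}} → ℕ → Set₁
ARd-≤ k b = Σ ℕ (λ m → m ≤ b × AdmissibleARd k m)

bound : ℕ → ℕ
bound k with k % 2
... | zero = 2 * (k Data.Nat.∸ 1)
... | suc _ = 2 * (k + 2)

{-# OPTIONS --safe #-}
-- Blow up C_k: replace vertex j by an independent layer of S j vertices and join consecutive
-- layers completely. A cycle copy is a choice of one vertex per layer. If layer e + 1 lies
-- between two layers whose vertices are already chosen and ℓ colours are in use, then each used
-- colour excludes at most two vertices of layer e + 1, so 2ℓ + 1 vertices suffice there. Hence,
-- with singletons in every other layer, the successive layers filled need sizes growing by 4.
-- Arranging them in the order last, first, last but one, second, ... makes every vertex of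
-- degree about 2k. For even k one of these layers is set apart between two single edges of the
-- cycle, and a layer of size 2 lets these two edges get different colours.
module Submission where

open import Defs
open import Data.Nat using (ℕ; _≤_; s≤s; z≤n; >-nonZero)
open import Data.Nat.Properties using (<-≤-trans)
open import Data.Nat using (NonZero; suc; _+_; _*_; _<_; _≟_; _<?_)
open import Data.Nat.Properties using (≤-refl; ≤-reflexive; ≤-trans; <-trans; <⇒≢; <⇒≤; ≤⇒≯; m≤n⇒m<n∨m≡n; m+n≤o⇒m≤o; m≤n+m; +-mono-≤; +-comm; n<1+n; n≤1+n; n<1⇒n≡0; suc-injective)
open import Data.Nat.DivMod using (_mod_; m%n<n; m<n⇒m%n≡m; n%n≡0; [m+kn]%n≡m%n)
open import Data.Nat.Tactic.RingSolver using (solve-∀)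
open import Data.Bool using (true; false)
open import Data.Fin using (Fin; zero; suc; toℕ; fromℕ; inject₁; combine; remQuot; _↑ˡ_; _↑ʳ_)
open import Data.Fin.Properties as Fin using (toℕ-injective; toℕ<n; toℕ-fromℕ; toℕ-fromℕ<; toℕ-inject₁; remQuot-combine; combine-remQuot; combine-injective; any?; pigeonhole; ↑ˡ-injective; ↑ʳ-injective)
open import Data.Fin.Subset as Subset using (∣_∣; ⁅_⁆; _∪_; ⋃)
open import Data.Fin.Subset.Properties using (∣⊥∣≡0; p⊆q⇒∣p∣≤∣q∣; p⊆p∪q; q⊆p∪q; x∈⁅x⁆; ∪-identityˡ; ∣p∣≤∣x∷p∣)
open import Data.Vec using ([]; _∷_)
open import Data.Vec.Properties using (lookup∘tabulate; []=⇒lookup)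
open import Data.List using (List; []; _∷_; length; map; _++_; applyUpTo)
open import Data.List.Properties using (length-map; length-++; length-applyUpTo)
open import Data.List.Membership.Propositional using (_∈_; _∉_)
open import Data.List.Membership.Propositional.Properties using (∈-map⁺; ∈-++⁺ˡ; ∈-++⁺ʳ; ∈-applyUpTo⁺)
open import Data.List.Membership.DecPropositional _≟_ using (_∈?_)
open import Data.List.Membership.Setoid.Properties using (index-injective)
open import Data.List.Relation.Unary.Any using (here; there; index)
open import Data.Product using (Σ; ∃; _×_; _,_; proj₁; proj₂)
open import Data.Sum using (_⊎_; inj₁; inj₂; swap; [_,_])
open import Function using (_∘_)
open import Relation.Nullary using (Dec; yes; no; does; _×-dec_; _⊎-dec_; ¬?; contradiction)
open import Relation.Nullary.Decidable using (decidable-stable)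
open import Relation.Binary.PropositionalEquality using (_≡_; _≢_; refl; trans; cong; cong₂; subst; subst₂; setoid) renaming (sym to ≡-sym)

-- Choosing an index that avoids given colours

≤-slack : ∀ {m n} d → m + d ≡ n → m ≤ n
≤-slack d eq = m+n≤o⇒m≤o _ (≤-reflexive eq)

InjectiveBelow : ℕ → (ℕ → ℕ) → Set
InjectiveBelow n g = ∀ {a b} → a < n → b < n → g a ≡ g b → a ≡ b

↑ˡ≢↑ʳ : ∀ {m n} (i : Fin m) (j : Fin n) → i ↑ˡ n ≢ m ↑ʳ j
↑ˡ≢↑ʳ (suc i) j eq = ↑ˡ≢↑ʳ i j (Fin.suc-injective eq)

-- If every index below `n` were excluded, send each to the position in `cs` of a colour excluding
-- it, with separate copies of the positions for `g` and for `h`. This is injective into fewer than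
-- `n` positions, against the pigeonhole principle.
simultaneously-avoid : ∀ {n} {g h : ℕ → ℕ} (cs : List ℕ) → InjectiveBelow n g → InjectiveBelow n h →
  length cs + length cs < n → ∃ λ a → a < n × g a ∉ cs × h a ∉ cs
simultaneously-avoid {n} {g} {h} cs g-inj h-inj lt
  with any? {n} (λ a → ¬? (g (toℕ a) ∈? cs) ×-dec ¬? (h (toℕ a) ∈? cs))
... | yes (a , ga∉ , ha∉) = toℕ a , toℕ<n a , ga∉ , ha∉
... | no none =
  let i , j , i<j , eq = pigeonhole lt (code ∘ excluded)
  in contradiction (cong toℕ (code-injective (excluded i) (excluded j) eq)) (<⇒≢ i<j)
  where
  Excluded : Fin n → Set
  Excluded a = g (toℕ a) ∈ cs ⊎ h (toℕ a) ∈ cs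

  excluded : ∀ a → Excluded a
  excluded a with g (toℕ a) ∈? cs
  ... | yes ga∈ = inj₁ ga∈
  ... | no  ga∉ = inj₂ (decidable-stable (h (toℕ a) ∈? cs) λ ha∉ → none (a , ga∉ , ha∉))

  code : ∀ {a} → Excluded a → Fin (length cs + length cs)
  code (inj₁ p) = index p ↑ˡ length cs
  code (inj₂ p) = length cs ↑ʳ index p

  code-injective : ∀ {a b} (p : Excluded a) (q : Excluded b) → code p ≡ code q → a ≡ b
  code-injective (inj₁ p) (inj₁ q) eq =
    toℕ-injective (g-inj (toℕ<n _) (toℕ<n _) (index-injective (setoid ℕ) p q (↑ˡ-injective _ _ _ eq)))
  code-injective (inj₂ p) (inj₂ q) eq =
    toℕ-injective (h-inj (toℕ<n _) (toℕ<n _) (index-injective (setoid ℕ) p q (↑ʳ-injective _ _ _ eq)))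
  code-injective (inj₁ p) (inj₂ q) eq = contradiction eq (↑ˡ≢↑ʳ _ _)
  code-injective (inj₂ p) (inj₁ q) eq = contradiction (≡-sym eq) (↑ˡ≢↑ʳ _ _)

-- Updates of a selection and layered colourings

infixl 5 _[_↦_]

_[_↦_] : (ℕ → ℕ) → ℕ → ℕ → ℕ → ℕ
(f [ p ↦ a ]) j with j ≟ p
... | yes _ = a
... | no _  = f j

[↦]-same : ∀ f p a → (f [ p ↦ a ]) p ≡ a
[↦]-same f p a with p ≟ p
... | yes _  = refl
... | no p≢p = contradiction refl p≢p

[↦]-other : ∀ f {p j} a → j ≢ p → (f [ p ↦ a ]) j ≡ f j
[↦]-other f {p} {j} a j≢p with j ≟ p
... | yes j≡p = contradiction j≡p j≢p
... | no _    = refl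

-- E e a b is the colour of the edge joining vertex a of layer e to vertex b of layer e + 1.
-- Layer K stands for layer 0 again, so edge e of the cycle joins layers e and e + 1 for e < K.
record LayeredColouring (K : ℕ) (S : ℕ → ℕ) (E : ℕ → ℕ → ℕ → ℕ) : Set where
  field
    injectiveʳ : ∀ {e x} → suc e < K → x < S e → InjectiveBelow (S (suc e)) (λ a → E e x a)
    injectiveˡ : ∀ {e y} → suc e < K → y < S (2 + e) → InjectiveBelow (S (suc e)) (λ a → E (suc e) a y)
    adjacent≢  : ∀ {e x a y} → suc e < K → x < S e → a < S (suc e) → y < S (2 + e) →
      E e x a ≢ E (suc e) a y

-- Sizes of the layers of a chain

width : ℕ → ℕ
width q = suc (q + q)

-- Sizes of the layers 0, …, 2m of a chain whose odd layers are filled when q colours are in use: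
-- first layer 3, then the inner chain starting at layer 4, and layer 1 last.
chain : ℕ → ℕ → ℕ → ℕ
chain q m             0                   = 1
chain q 0             (suc j)             = 1
chain q 1             1                   = width q
chain q 1             (suc (suc j))       = 1
chain q (suc (suc m)) 1                   = width (m * 2 + (2 + q))
chain q (suc (suc m)) 2                   = 1
chain q (suc (suc m)) 3                   = width q
chain q (suc (suc m)) (suc (suc (suc (suc j)))) = chain (2 + q) m j

-- The last layer of the chain will be layer `K`, that is layer 0 again, so its size has to match.
chain-last : ∀ q m → chain q m (m * 2) ≡ 1
chain-last q 0             = refl
chain-last q 1             = refl
chain-last q (suc (suc m)) = chain-last (2 + q) m

1≤chain : ∀ q m j → 1 ≤ chain q m j
1≤chain q m             0                   = ≤-refl
1≤chain q 0             (suc j)             = ≤-refl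
1≤chain q 1             1                   = s≤s z≤n
1≤chain q 1             (suc (suc j))       = ≤-refl
1≤chain q (suc (suc m)) 1                   = s≤s z≤n
1≤chain q (suc (suc m)) 2                   = s≤s z≤n
1≤chain q (suc (suc m)) 3                   = s≤s z≤n
1≤chain q (suc (suc m)) (suc (suc (suc (suc j)))) = 1≤chain (2 + q) m j

-- For m ≥ 1 the largest layer is the last one filled, of size 2(q + 2(m - 1)) + 1, which is 2p + 4m
-- - 1 for q = p + 1. The bound is rounded up to cover m = 0 as well.
chain-≤ : ∀ p m j → chain (suc p) m j ≤ 2 + (p + p) + m * 4
chain-≤ p m             0             = s≤s z≤n
chain-≤ p 0             (suc j)       = s≤s z≤n
chain-≤ p 1             1             = ≤-slack 3 (eq p)
  where
  eq : ∀ p → suc (suc p + suc p) + 3 ≡ 2 + (p + p) + 1 * 4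
  eq = solve-∀
chain-≤ p 1             (suc (suc j)) = s≤s z≤n
chain-≤ p (suc (suc m)) 1             = ≤-slack 3 (eq p m)
  where
  eq : ∀ p m → suc (m * 2 + (3 + p) + (m * 2 + (3 + p))) + 3 ≡ 2 + (p + p) + (2 + m) * 4
  eq = solve-∀
chain-≤ p (suc (suc m)) 2             = s≤s z≤n
chain-≤ p (suc (suc m)) 3             = ≤-slack (7 + m * 4) (eq p m)
  where
  eq : ∀ p m → suc (suc p + suc p) + (7 + m * 4) ≡ 2 + (p + p) + (2 + m) * 4
  eq = solve-∀
chain-≤ p (suc (suc m)) (suc (suc (suc (suc j)))) =
  ≤-trans (chain-≤ (2 + p) m j) (≤-slack 4 (eq p m))
  where
  eq : ∀ p m → 2 + (2 + p + (2 + p)) + m * 4 + 4 ≡ 2 + (p + p) + (2 + m) * 4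
  eq = solve-∀

-- Even layers are singletons, and consecutive odd layers come from opposite ends of the filling
-- order. Layers 1 and 3 together have 4q + 4m - 2 vertices, which is the bound for q = p + 1;
-- passing to the inner chain replaces (q, m) by (q + 2, m - 2) and leaves this number unchanged.
chain-+-≤ : ∀ p m j → chain (suc p) m j + chain (suc p) m (2 + j) ≤ 2 + p * 4 + m * 4
chain-+-≤ p 0             0       = s≤s (s≤s z≤n)
chain-+-≤ p 0             (suc j) = s≤s (s≤s z≤n)
chain-+-≤ p 1             0       = s≤s (s≤s z≤n)
chain-+-≤ p 1             1       = ≤-slack (2 + p * 2) (eq p)
  where
  eq : ∀ p → suc (suc p + suc p) + 1 + (2 + p * 2) ≡ 2 + p * 4 + 1 * 4
  eq = solve-∀
chain-+-≤ p 1             (suc (suc j)) = s≤s (s≤s z≤n)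
chain-+-≤ p (suc (suc m)) 0       = s≤s (s≤s z≤n)
chain-+-≤ p (suc (suc m)) 1       = ≤-reflexive (eq p m)
  where
  eq : ∀ p m → suc (m * 2 + (3 + p) + (m * 2 + (3 + p))) + suc (suc p + suc p) ≡ 2 + p * 4 + (2 + m) * 4
  eq = solve-∀
chain-+-≤ p (suc (suc m)) 2       = s≤s (s≤s z≤n)
-- Layer 3 is the first filled, and the next odd layer, if the inner chain has one, is the last but
-- one; `inner` bounds the latter by what `width (suc p)` leaves of the total.
chain-+-≤ p (suc (suc m)) 3       =
  ≤-trans (+-mono-≤ (≤-refl {width (suc p)}) (inner m)) (≤-slack 0 (eq p m))
  where
  inner : ∀ m → chain (3 + p) m 1 ≤ 7 + p * 2 + m * 4
  inner 0             = s≤s z≤n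
  inner 1             = ≤-slack 4 (eq₁ p)
    where
    eq₁ : ∀ p → suc (3 + p + (3 + p)) + 4 ≡ 7 + p * 2 + 1 * 4
    eq₁ = solve-∀
  inner (suc (suc m)) = ≤-slack 4 (eq₂ p m)
    where
    eq₂ : ∀ p m → suc (m * 2 + (5 + p) + (m * 2 + (5 + p))) + 4 ≡ 7 + p * 2 + (2 + m) * 4
    eq₂ = solve-∀
  eq : ∀ p m → suc (suc p + suc p) + (7 + p * 2 + m * 4) + 0 ≡ 2 + p * 4 + (2 + m) * 4
  eq = solve-∀
chain-+-≤ p (suc (suc m)) (suc (suc (suc (suc j)))) =
  ≤-trans (chain-+-≤ (2 + p) m j) (≤-reflexive (eq p m))
  where
  eq : ∀ p m → 2 + (2 + p) * 4 + m * 4 ≡ 2 + p * 4 + (2 + m) * 4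
  eq = solve-∀

-- The edges covered by filling a chain

chainEdges : ℕ → ℕ → List ℕ → List ℕ
chainEdges o 0             es = es
chainEdges o 1             es = o ∷ suc o ∷ es
-- Latest edges first: layer `3 + o` is filled first, then the chain from `4 + o`, and layer `1 + o`
-- last.
chainEdges o (suc (suc m)) es = o ∷ suc o ∷ chainEdges (4 + o) m (2 + o ∷ 3 + o ∷ es)

length-chainEdges : ∀ o m es → length (chainEdges o m es) ≡ m * 2 + length es
length-chainEdges o 0             es = refl
length-chainEdges o 1             es = refl
length-chainEdges o (suc (suc m)) es =
  cong (2 +_) (trans (length-chainEdges (4 + o) m _) (eq m (length es)))
  where
  eq : ∀ m ℓ → m * 2 + (2 + ℓ) ≡ 2 + (m * 2 + ℓ)
  eq = solve-∀

chainEdges-⊇ : ∀ o m {es e} → e ∈ es → e ∈ chainEdges o m es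
chainEdges-⊇ o 0             e∈ = e∈
chainEdges-⊇ o 1             e∈ = there (there e∈)
chainEdges-⊇ o (suc (suc m)) e∈ = there (there (chainEdges-⊇ (4 + o) m (there (there e∈))))

∈-chainEdges⁺ : ∀ o m {es} j → j < m * 2 → j + o ∈ chainEdges o m es
∈-chainEdges⁺ o 1             0 _ = here refl
∈-chainEdges⁺ o 1             1 _ = there (here refl)
∈-chainEdges⁺ o 1             (suc (suc j)) (s≤s (s≤s ()))
∈-chainEdges⁺ o (suc (suc m)) 0 _ = here refl
∈-chainEdges⁺ o (suc (suc m)) 1 _ = there (here refl)
∈-chainEdges⁺ o (suc (suc m)) 2 _ = there (there (chainEdges-⊇ (4 + o) m (here refl)))
∈-chainEdges⁺ o (suc (suc m)) 3 _ = there (there (chainEdges-⊇ (4 + o) m (there (here refl))))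
∈-chainEdges⁺ o (suc (suc m)) {es} (suc (suc (suc (suc j)))) (s≤s (s≤s (s≤s (s≤s j<)))) =
  there (there (subst (_∈ chainEdges (4 + o) m (2 + o ∷ 3 + o ∷ es)) (eq j o) (∈-chainEdges⁺ (4 + o) m j j<)))
  where
  eq : ∀ j o → j + (4 + o) ≡ 4 + (j + o)
  eq = solve-∀

-- Used to show that the two edges at a layer filled after a chain are not yet coloured.
∈-chainEdges⁻ : ∀ o m {es e} → e ∈ chainEdges o m es → e ∈ es ⊎ o ≤ e × e < m * 2 + o
∈-chainEdges⁻ o 0             e∈               = inj₁ e∈
∈-chainEdges⁻ o 1             (here refl)         = inj₂ (≤-refl , n≤1+n _)
∈-chainEdges⁻ o 1             (there (here refl)) = inj₂ (n≤1+n _ , ≤-refl)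
∈-chainEdges⁻ o 1             (there (there e∈))  = inj₁ e∈
∈-chainEdges⁻ o (suc (suc m)) (here refl)         = inj₂ (≤-refl , s≤s (m≤n+m o (3 + m * 2)))
∈-chainEdges⁻ o (suc (suc m)) (there (here refl)) = inj₂ (n≤1+n _ , s≤s (s≤s (m≤n+m o (2 + m * 2))))
∈-chainEdges⁻ o (suc (suc m)) (there (there e∈))  with ∈-chainEdges⁻ (4 + o) m e∈
... | inj₁ (here refl)          = inj₂ (m≤n+m o 2 , s≤s (s≤s (s≤s (m≤n+m o (1 + m * 2)))))
... | inj₁ (there (here refl))  = inj₂ (m≤n+m o 3 , s≤s (s≤s (s≤s (s≤s (m≤n+m o (m * 2))))))
... | inj₁ (there (there e∈es)) = inj₁ e∈es
... | inj₂ (4+o≤e , e<)         =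
  inj₂ (≤-trans (m≤n+m o 4) 4+o≤e , ≤-trans e< (≤-reflexive (eq m o)))
  where
  eq : ∀ m o → m * 2 + (4 + o) ≡ (2 + m) * 2 + o
  eq = solve-∀

-- Greedy selection of one vertex per layer

module Selection {K S E} (L : LayeredColouring K S E) where
  open LayeredColouring L

  hue : (ℕ → ℕ) → ℕ → ℕ
  hue f e = E e (f e) (f (suc e))

  RainbowOn : List ℕ → (ℕ → ℕ) → Set
  RainbowOn es f = ∀ {i j} → i ∈ es → j ∈ es → hue f i ≡ hue f j → i ≡ j

  -- The selection is total: a layer still to be filled carries a provisional vertex, which matters
  -- only once an edge at that layer enters `es`.
  Selected : List ℕ → Set
  Selected es = ∃ λ f → (∀ j → f j < S j) × RainbowOn es f

  -- Changing `f` at layer `suc e` affects only the edges `e` and `suc e`, which are outside `es`,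
  -- so the colours in use persist. The new vertex avoids them on both edges at once, and the two
  -- new colours differ because these edges share a vertex.
  fill-layer : ∀ {es} e → suc e < K → e ∉ es → suc e ∉ es → width (length es) ≤ S (suc e) →
    Selected es → Selected (e ∷ suc e ∷ es)
  fill-layer {es} e e<K e∉ 1+e∉ wide (f , f< , rb) = f′ , f′< , rb′
    where
    cs : List ℕ
    cs = map (hue f) es

    pick : ∃ λ a → a < S (suc e) × E e (f e) a ∉ cs × E (suc e) a (f (2 + e)) ∉ cs
    pick = simultaneously-avoid cs (injectiveʳ e<K (f< e)) (injectiveˡ e<K (f< (2 + e)))
      (subst (λ ℓ → ℓ + ℓ < S (suc e)) (≡-sym (length-map (hue f) es)) wide)

    a = proj₁ pick
    a< = proj₁ (proj₂ pick)
    left∉ = proj₁ (proj₂ (proj₂ pick))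
    right∉ = proj₂ (proj₂ (proj₂ pick))

    f′ : ℕ → ℕ
    f′ = f [ suc e ↦ a ]

    f′< : ∀ j → f′ j < S j
    f′< j with j ≟ suc e
    ... | yes refl = a<
    ... | no _     = f< j

    hue-left : hue f′ e ≡ E e (f e) a
    hue-left = cong₂ (E e) ([↦]-other f a (<⇒≢ ≤-refl)) ([↦]-same f (suc e) a)

    hue-right : hue f′ (suc e) ≡ E (suc e) a (f (2 + e))
    hue-right = cong₂ (E (suc e)) ([↦]-same f (suc e) a) ([↦]-other f a (<⇒≢ ≤-refl ∘ ≡-sym))

    -- Edge `i` reads `f` at layers `i` and `suc i`; these differ from layer `suc e` because `suc e`
    -- and `e` respectively are not in `es`.
    hue-old : ∀ {i} → i ∈ es → hue f′ i ≡ hue f i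
    hue-old {i} i∈ = cong₂ (E i)
      ([↦]-other f a λ { refl → 1+e∉ i∈ })
      ([↦]-other f {suc e} a λ { refl → e∉ i∈ })

    left≢old : ∀ {i} → i ∈ es → hue f′ e ≢ hue f′ i
    left≢old i∈ eq = left∉ (subst (_∈ cs) (trans (≡-sym (hue-old i∈)) (trans (≡-sym eq) hue-left)) (∈-map⁺ (hue f) i∈))

    right≢old : ∀ {i} → i ∈ es → hue f′ (suc e) ≢ hue f′ i
    right≢old i∈ eq = right∉ (subst (_∈ cs) (trans (≡-sym (hue-old i∈)) (trans (≡-sym eq) hue-right)) (∈-map⁺ (hue f) i∈))

    left≢right : hue f′ e ≢ hue f′ (suc e)
    left≢right eq = adjacent≢ e<K (f< e) a< (f< (2 + e)) (trans (≡-sym hue-left) (trans eq hue-right))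

    rb′ : RainbowOn (e ∷ suc e ∷ es) f′
    rb′ (here refl)         (here refl)         _  = refl
    rb′ (here refl)         (there (here refl)) eq = contradiction eq left≢right
    rb′ (here refl)         (there (there j∈))  eq = contradiction eq (left≢old j∈)
    rb′ (there (here refl)) (here refl)         eq = contradiction (≡-sym eq) left≢right
    rb′ (there (here refl)) (there (here refl)) _  = refl
    rb′ (there (here refl)) (there (there j∈))  eq = contradiction eq (right≢old j∈)
    rb′ (there (there i∈))  (here refl)         eq = contradiction (≡-sym eq) (left≢old i∈)
    rb′ (there (there i∈))  (there (here refl)) eq = contradiction (≡-sym eq) (right≢old i∈)
    rb′ (there (there i∈))  (there (there j∈))  eq =
      rb i∈ j∈ (trans (≡-sym (hue-old i∈)) (trans eq (hue-old j∈)))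

  -- The recursion follows `chain`: the inner chain starts with two more colours in use, and for
  -- layer `suc o`, filled last, `length-chainEdges` supplies the number of colours in use.
  fill-chain : ∀ {es} o m → (∀ j → chain (length es) m j ≤ S (j + o)) → m * 2 + o ≤ K →
    (∀ j → j < m * 2 → j + o ∉ es) → Selected es → Selected (chainEdges o m es)
  fill-chain o 0             _    _   _     sel = sel
  fill-chain o 1             wide o≤K fresh sel =
    fill-layer o o≤K (fresh 0 (s≤s z≤n)) (fresh 1 ≤-refl) (wide 1) sel
  fill-chain {es} o (suc (suc m)) wide o≤K fresh sel =
    fill-layer o (≤-trans (s≤s (s≤s (m≤n+m o (2 + m * 2)))) o≤K) (outside 0 (s≤s z≤n)) (outside 1 ≤-refl)
      (subst (λ ℓ → width ℓ ≤ S (suc o)) (≡-sym (length-chainEdges (4 + o) m es₁)) (wide 1))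
      (fill-chain (4 + o) m
        (λ j → subst (λ i → chain (2 + length es) m j ≤ S i) (≡-sym (shift j)) (wide (4 + j)))
        (subst (_≤ K) (≡-sym (shift (m * 2))) o≤K)
        fresh₁
        (fill-layer (2 + o) (≤-trans (s≤s (s≤s (s≤s (s≤s (m≤n+m o (m * 2)))))) o≤K)
          (fresh 2 (s≤s (s≤s (s≤s z≤n)))) (fresh 3 (s≤s (s≤s (s≤s (s≤s z≤n))))) (wide 3) sel))
    where
    es₁ : List ℕ
    es₁ = 2 + o ∷ 3 + o ∷ es

    shift : ∀ j → j + (4 + o) ≡ 4 + (j + o)
    shift j = eq j o
      where
      eq : ∀ j o → j + (4 + o) ≡ 4 + (j + o)
      eq = solve-∀

    fresh₁ : ∀ j → j < m * 2 → j + (4 + o) ∉ es₁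
    fresh₁ j j< p with subst (_∈ es₁) (shift j) p
    ... | here eq         = <⇒≢ (s≤s (s≤s (s≤s (≤-trans (m≤n+m o j) (n≤1+n _))))) (≡-sym eq)
    ... | there (here eq) = <⇒≢ (s≤s (s≤s (s≤s (s≤s (m≤n+m o j))))) (≡-sym eq)
    ... | there (there q) = fresh (4 + j) (s≤s (s≤s (s≤s (s≤s j<)))) q

    outside : ∀ i → i < 2 → i + o ∉ chainEdges (4 + o) m es₁
    outside i i<2 p with ∈-chainEdges⁻ (4 + o) m p
    ... | inj₁ (here eq)         = <⇒≢ (+-mono-≤ i<2 (≤-refl {o})) eq
    ... | inj₁ (there (here eq)) = <⇒≢ (≤-trans (+-mono-≤ i<2 (≤-refl {o})) (n≤1+n _)) eq
    ... | inj₁ (there (there q)) = fresh i (≤-trans i<2 (s≤s (s≤s z≤n))) q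
    ... | inj₂ (4+o≤ , _)        = ≤⇒≯ 4+o≤ (≤-trans (+-mono-≤ i<2 (≤-refl {o})) (m≤n+m (2 + o) 2))

-- Bounding a degree by a list of neighbours

∣⁅x⁆∪p∣≤1+∣p∣ : ∀ {n} (x : Fin n) p → ∣ ⁅ x ⁆ ∪ p ∣ ≤ suc ∣ p ∣
∣⁅x⁆∪p∣≤1+∣p∣ zero    (s ∷ p)     = subst (λ q → suc ∣ q ∣ ≤ suc ∣ s ∷ p ∣) (≡-sym (∪-identityˡ p)) (s≤s (∣p∣≤∣x∷p∣ s p))
∣⁅x⁆∪p∣≤1+∣p∣ (suc x) (true ∷ p)  = s≤s (∣⁅x⁆∪p∣≤1+∣p∣ x p)
∣⁅x⁆∪p∣≤1+∣p∣ (suc x) (false ∷ p) = ∣⁅x⁆∪p∣≤1+∣p∣ x p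

∣⋃⁅xs⁆∣≤length : ∀ {n} (xs : List (Fin n)) → ∣ ⋃ (map ⁅_⁆ xs) ∣ ≤ length xs
∣⋃⁅xs⁆∣≤length {n} []       = ≤-reflexive (∣⊥∣≡0 n)
∣⋃⁅xs⁆∣≤length     (x ∷ xs) = ≤-trans (∣⁅x⁆∪p∣≤1+∣p∣ x _) (s≤s (∣⋃⁅xs⁆∣≤length xs))

∈-⋃⁅⁆ : ∀ {n} {x : Fin n} {xs} → x ∈ xs → x Subset.∈ ⋃ (map ⁅_⁆ xs)
∈-⋃⁅⁆ {x = x} {xs = _ ∷ xs} (here refl) = p⊆p∪q (⋃ (map ⁅_⁆ xs)) (x∈⁅x⁆ x)
∈-⋃⁅⁆ {xs = y ∷ xs}         (there x∈)  = q⊆p∪q ⁅ y ⁆ (⋃ (map ⁅_⁆ xs)) (∈-⋃⁅⁆ x∈)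

does≡true⇒ : ∀ {A : Set} (A? : Dec A) → does A? ≡ true → A
does≡true⇒ (yes a) _ = a

degree-≤-length : ∀ {n} (G : Graph n) v xs → (∀ {u} → Adj G v u → u ∈ xs) → degree G v ≤ length xs
degree-≤-length G v xs covers = ≤-trans (p⊆q⇒∣p∣≤∣q∣ λ u∈ → ∈-⋃⁅⁆ (covers (adjacent u∈))) (∣⋃⁅xs⁆∣≤length xs)
  where
  adjacent : ∀ {u} → u Subset.∈ nbhd G v → Adj G v u
  adjacent {u} u∈ = does≡true⇒ (adj? G v u) (trans (≡-sym (lookup∘tabulate _ u)) ([]=⇒lookup u∈))

-- Successor and predecessor on the cycle

toℕ-mod-< : ∀ {a n} .{{_ : NonZero n}} → a < n → toℕ (a mod n) ≡ a
toℕ-mod-< {a} {n} a<n = trans (toℕ-fromℕ< (m%n<n a n)) (m<n⇒m%n≡m a<n)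

toℕ-n-mod-n : ∀ n .{{_ : NonZero n}} → toℕ (n mod n) ≡ 0
toℕ-n-mod-n n = trans (toℕ-fromℕ< (m%n<n n n)) (n%n≡0 n)

toℕ-next : ∀ {k} (i : Fin (suc k)) →
  suc (toℕ i) < suc k × toℕ (next i) ≡ suc (toℕ i) ⊎ toℕ i ≡ k × toℕ (next i) ≡ 0
toℕ-next {k} i with m≤n⇒m<n∨m≡n (toℕ<n i)
... | inj₁ 1+i<1+k = inj₁ (1+i<1+k , toℕ-mod-< 1+i<1+k)
... | inj₂ 1+i≡1+k = inj₂ (suc-injective 1+i≡1+k ,
  trans (cong (λ t → toℕ (t mod suc k)) 1+i≡1+k) (toℕ-n-mod-n (suc k)))

prev : ∀ {k} → Fin (suc k) → Fin (suc k)
prev {k} zero    = fromℕ k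
prev     (suc i) = inject₁ i

≡next⇒prev≡ : ∀ {k} {i j : Fin (suc k)} → i ≡ next j → j ≡ prev i
≡next⇒prev≡ {k} {zero} {j} eq with toℕ-next j
... | inj₁ (_ , t)   = contradiction (trans (cong toℕ eq) t) λ ()
... | inj₂ (j≡k , _) = toℕ-injective (trans j≡k (≡-sym (toℕ-fromℕ k)))
≡next⇒prev≡ {k} {suc i} {j} eq with toℕ-next j
... | inj₁ (_ , t) = toℕ-injective (trans (≡-sym (suc-injective (trans (cong toℕ eq) t))) (≡-sym (toℕ-inject₁ i)))
... | inj₂ (_ , t) = contradiction (trans (cong toℕ eq) t) λ ()

next≢ : ∀ {k} (i : Fin (2 + k)) → i ≢ next i
next≢ i eq with toℕ-next i
... | inj₁ (_ , t)     = <⇒≢ ≤-refl (trans (cong toℕ eq) t)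
-- At least two layers are needed here: the last index `1 + k` is positive, while its successor is
-- 0.
... | inj₂ (i≡1+k , t) = contradiction (trans (≡-sym i≡1+k) (trans (cong toℕ eq) t)) λ ()

-- The blow-up, its degrees and its colourings

-- Every layer gets suc M vertices; those with index ≥ S j in layer j are isolated.
module Blowup (k′ M : ℕ) (S : ℕ → ℕ) (S≤ : ∀ j → S j ≤ suc M) (S-wrap : S (3 + k′) ≡ S 0) where

  K : ℕ
  K = 3 + k′

  layer : Fin (K * suc M) → Fin K
  layer u = proj₁ (remQuot {K} (suc M) u)

  position : Fin (K * suc M) → Fin (suc M)
  position u = proj₂ (remQuot {K} (suc M) u)

  Present : Fin (K * suc M) → Set
  Present u = toℕ (position u) < S (toℕ (layer u))

  blowup : Graph (K * suc M)
  blowup = record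
    { Adj    = λ u v → Present u × Present v × (layer v ≡ next (layer u) ⊎ layer u ≡ next (layer v))
    ; adj?   = λ u v → (_ <? _) ×-dec (_ <? _) ×-dec ((_ Fin.≟ _) ⊎-dec (_ Fin.≟ _))
    ; sym    = λ (pu , pv , l) → pv , pu , swap l
    ; irrefl = λ (_ , _ , l) → [ next≢ _ , next≢ _ ] l
    }

  layerList : Fin K → List (Fin (K * suc M))
  layerList j = applyUpTo (λ a → combine j (a mod suc M)) (S (toℕ j))

  length-layerList : ∀ j → length (layerList j) ≡ S (toℕ j)
  length-layerList j = length-applyUpTo (λ a → combine j (a mod suc M)) (S (toℕ j))

  ∈-layerList : ∀ {u} → Present u → u ∈ layerList (layer u)
  ∈-layerList {u} pu = subst (_∈ layerList (layer u))
    (trans (cong (combine (layer u)) (toℕ-injective (toℕ-mod-< (toℕ<n (position u))))) (combine-remQuot {K} (suc M) u))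
    (∈-applyUpTo⁺ _ pu)

  degree-≤ : ∀ v → degree blowup v ≤ S (toℕ (next (layer v))) + S (toℕ (prev (layer v)))
  degree-≤ v = ≤-trans (degree-≤-length blowup v nbrs covers) (≤-reflexive
    (trans (length-++ (layerList (next (layer v)))) (cong₂ _+_ (length-layerList (next (layer v))) (length-layerList (prev (layer v))))))
    where
    nbrs : List (Fin (K * suc M))
    nbrs = layerList (next (layer v)) ++ layerList (prev (layer v))

    covers : ∀ {u} → Adj blowup v u → u ∈ nbrs
    covers {u} (_ , pu , inj₁ eq) = ∈-++⁺ˡ (subst (λ j → u ∈ layerList j) eq (∈-layerList pu))
    covers {u} (_ , pu , inj₂ eq) =
      ∈-++⁺ʳ (layerList (next (layer v))) (subst (λ j → u ∈ layerList j) (≡next⇒prev≡ eq) (∈-layerList pu))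

  -- Layer 0 lies between layers 1 and `2 + k′`; any other layer `suc j` lies between `j` and
  -- `2 + j`, where layer `K` replaces layer 0 by `S-wrap`.
  maxDegree : ∀ {D} → S 1 + S (2 + k′) ≤ D → (∀ j → 2 + j ≤ K → S j + S (2 + j) ≤ D) → MaxDegreeAtMost blowup D
  maxDegree {D} ends inner v = ≤-trans (degree-≤ v) (around (layer v))
    where
    around : ∀ i → S (toℕ (next i)) + S (toℕ (prev i)) ≤ D
    around zero = subst (λ t → S 1 + S t ≤ D) (≡-sym (toℕ-fromℕ (2 + k′))) ends
    around (suc i) with toℕ-next (suc i)
    ... | inj₁ (2+i<K , t) = subst₂ (λ x y → S x + S y ≤ D) (≡-sym t) (≡-sym (toℕ-inject₁ i))
      (≤-trans (≤-reflexive (+-comm (S (2 + toℕ i)) _)) (inner (toℕ i) (<⇒≤ 2+i<K)))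
    ... | inj₂ (1+i≡2+k′ , t) = subst₂ (λ x y → x + S y ≤ D)
      (trans (trans (cong (S ∘ suc) 1+i≡2+k′) S-wrap) (cong S (≡-sym t))) (≡-sym (toℕ-inject₁ i))
      (≤-trans (≤-reflexive (+-comm (S (2 + toℕ i)) _)) (inner (toℕ i) (≤-reflexive (cong suc 1+i≡2+k′))))

  -- Total in both arguments: reduction modulo `K` identifies layer `K` with layer 0, and reduction
  -- modulo `suc M` fixes every index below `S i`.
  vertex : ℕ → ℕ → Fin (K * suc M)
  vertex i a = combine (i mod K) (a mod suc M)

  toℕ-position : ∀ {j a} → a < S j → toℕ (a mod suc M) ≡ a
  toℕ-position {j} a< = toℕ-mod-< (<-≤-trans a< (S≤ j))

  S-mod : ∀ {i} → i ≤ K → S (toℕ (i mod K)) ≡ S i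
  S-mod i≤K with m≤n⇒m<n∨m≡n i≤K
  ... | inj₁ i<K  = cong S (toℕ-mod-< i<K)
  ... | inj₂ refl = trans (cong S (toℕ-n-mod-n K)) (≡-sym S-wrap)

  layer-vertex : ∀ i a → layer (vertex i a) ≡ i mod K
  layer-vertex i a = cong proj₁ (remQuot-combine {K} {suc M} (i mod K) (a mod suc M))

  position-vertex : ∀ i a → position (vertex i a) ≡ a mod suc M
  position-vertex i a = cong proj₂ (remQuot-combine {K} {suc M} (i mod K) (a mod suc M))

  present : ∀ {i a} → i ≤ K → a < S i → Present (vertex i a)
  present {i} {a} i≤K a< = subst₂ _<_
    (≡-sym (trans (cong toℕ (position-vertex i a)) (toℕ-position {i} a<)))
    (≡-sym (trans (cong (S ∘ toℕ) (layer-vertex i a)) (S-mod i≤K))) a<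

  consecutive : ∀ {i a b} → i < K → a < S i → b < S (suc i) → Adj blowup (vertex i a) (vertex (suc i) b)
  consecutive {i} {a} {b} i<K a< b< = present (≤-trans (n≤1+n i) i<K) a< , present i<K b< , inj₁
    (trans (layer-vertex (suc i) b) (≡-sym
      (trans (cong next (layer-vertex i a)) (cong (λ t → suc t mod K) (toℕ-mod-< i<K)))))

  consecutive-reversed : ∀ {i a b} → i < K → a < S i → b < S (suc i) → Adj blowup (vertex (suc i) b) (vertex i a)
  consecutive-reversed {i} {a} {b} i<K a< b< =
    Graph.sym blowup {vertex i a} {vertex (suc i) b} (consecutive i<K a< b<)

  vertex-injectiveʳ : ∀ {i j a b} → a < S j → b < S j → vertex i a ≡ vertex i b → a ≡ b
  vertex-injectiveʳ {i} {j} {a} {b} a< b< eq = trans (≡-sym (toℕ-position {j} a<))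
    (trans (cong toℕ (proj₂ (combine-injective (i mod K) (a mod suc M) (i mod K) (b mod suc M) eq))) (toℕ-position {j} b<))

  -- This uses `K` ≥ 3: if `2 + e` wraps round to layer 0, then `e` is K - 2, which is positive.
  vertex-two-apart : ∀ {e x y} → suc e < K → vertex e x ≢ vertex (2 + e) y
  vertex-two-apart {e} {x} {y} 1+e<K eq
    with cong toℕ (proj₁ (combine-injective (e mod K) (x mod suc M) _ _ eq)) | m≤n⇒m<n∨m≡n 1+e<K
  ... | t | inj₁ 2+e<K = <⇒≢ (n≤1+n (suc e))
    (trans (≡-sym (toℕ-mod-< (<-trans (n<1+n e) 1+e<K))) (trans t (toℕ-mod-< 2+e<K)))
  ... | t | inj₂ refl = contradiction
    (trans (≡-sym (toℕ-mod-< (<-trans (n<1+n e) 1+e<K))) (trans t (toℕ-n-mod-n K))) λ ()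

  module _ (c : EdgeColouring blowup) (c-proper : Proper c) where

    E : ℕ → ℕ → ℕ → ℕ
    E e a b = col c (vertex e a) (vertex (suc e) b)

    E-reversed : ∀ {e a b} → e < K → a < S e → b < S (suc e) →
      E e a b ≡ col c (vertex (suc e) b) (vertex e a)
    E-reversed {e} {a} {b} e<K a< b< = col-sym c {vertex e a} {vertex (suc e) b} (consecutive e<K a< b<)

    -- Each field is properness at one vertex: in layer `e` for `injectiveʳ`, in layer `2 + e` for
    -- `injectiveˡ`, and in the middle layer for `adjacent≢`. `E-reversed` turns the edges that `E`
    -- reads towards that vertex.
    layered : LayeredColouring K S E
    layered = record
      { injectiveʳ = λ {e} {x} 1+e<K x< {a} {b} a< b< eq → decidable-stable (a ≟ b) λ a≢b →
          c-proper (vertex e x) (vertex (suc e) a) (vertex (suc e) b)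
            (consecutive (<⇒≤ 1+e<K) x< a<) (consecutive (<⇒≤ 1+e<K) x< b<)
            (a≢b ∘ vertex-injectiveʳ {suc e} {suc e} a< b<) eq
      ; injectiveˡ = λ {e} {y} 1+e<K y< {a} {b} a< b< eq → decidable-stable (a ≟ b) λ a≢b →
          c-proper (vertex (2 + e) y) (vertex (suc e) a) (vertex (suc e) b)
            (consecutive-reversed 1+e<K a< y<) (consecutive-reversed 1+e<K b< y<)
            (a≢b ∘ vertex-injectiveʳ {suc e} {suc e} a< b<)
            (trans (≡-sym (E-reversed 1+e<K a< y<)) (trans eq (E-reversed 1+e<K b< y<)))
      ; adjacent≢ = λ {e} {x} {a} {y} 1+e<K x< a< y< eq →
          c-proper (vertex (suc e) a) (vertex e x) (vertex (2 + e) y)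
            (consecutive-reversed (<⇒≤ 1+e<K) x< a<) (consecutive 1+e<K a< y<)
            (vertex-two-apart {e} {x} {y} 1+e<K) (trans (≡-sym (E-reversed (<⇒≤ 1+e<K) x< a<)) eq)
      }

    -- Layers 0 and `K` have size 1, so `f K` and `f 0` are both 0 and the last edge closes the
    -- cycle. The vertices are distinct because their layers are.
    rainbow-cycle : S 0 ≡ 1 → (es : List ℕ) → (∀ {i} → i < K → i ∈ es) →
      Selection.Selected layered es → Σ (CycleCopy blowup K) (Rainbow c)
    rainbow-cycle S0≡1 es full (f , f< , rb) = cycle , rainbow
      where
      open Selection layered using (hue)

      f-wrap : f K ≡ f 0
      f-wrap = trans (n<1⇒n≡0 (subst (f K <_) (trans S-wrap S0≡1) (f< K)))
        (≡-sym (n<1⇒n≡0 (subst (f 0 <_) S0≡1 (f< 0))))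

      at : Fin K → Fin (K * suc M)
      at i = vertex (toℕ i) (f (toℕ i))

      toℕ-mod-toℕ : ∀ i → toℕ i mod K ≡ i
      toℕ-mod-toℕ i = toℕ-injective (toℕ-mod-< (toℕ<n i))

      at-next : ∀ i → at (next i) ≡ vertex (suc (toℕ i)) (f (suc (toℕ i)))
      at-next i = cong₂ (λ j a → combine j (a mod suc M)) (toℕ-mod-toℕ (next i)) (f-next (toℕ-next i))
        where
        f-next : _ → f (toℕ (next i)) ≡ f (suc (toℕ i))
        f-next (inj₁ (_ , t))      = cong f t
        f-next (inj₂ (i≡2+k′ , t)) = trans (cong f t) (trans (≡-sym f-wrap) (cong (f ∘ suc) (≡-sym i≡2+k′)))

      cycle : CycleCopy blowup K
      cycle = record
        { vert = at
        ; inj  = λ {i} {j} eq → trans (≡-sym (toℕ-mod-toℕ i))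
            (trans (proj₁ (combine-injective (toℕ i mod K) (f (toℕ i) mod suc M) _ _ eq)) (toℕ-mod-toℕ j))
        ; edge = λ i → subst (Adj blowup (at i)) (≡-sym (at-next i)) (consecutive (toℕ<n i) (f< _) (f< _))
        }

      rainbow : Rainbow c cycle
      rainbow i j eq = toℕ-injective (rb (full (toℕ<n i)) (full (toℕ<n j))
        (subst₂ (λ u v → col c (at i) u ≡ col c (at j) v) (at-next i) (at-next j) eq))

-- Layer sizes and the bounds for odd and even cycles

oddSizes : ℕ → ℕ → ℕ
oddSizes m 0       = 1
oddSizes m (suc j) = chain 1 m j

-- The chain from layer 4 starts when edges 0 and 3 are coloured, hence `chain 2`. Layer 2 is filled
-- after it, with `m * 2 + 2` colours in use.
evenSizes : ℕ → ℕ → ℕ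
evenSizes m 0 = 1
evenSizes m 1 = 2
evenSizes m 2 = width (m * 2 + 2)
evenSizes m 3 = 1
evenSizes m (suc (suc (suc (suc j)))) = chain 2 m j

-- Edge 0 joins two singletons and gives the one colour in use when the chain on layers 1 to `K`
-- starts. With k = 3 + 2m, layer sizes and sums within the chain are at most 2k, and a singleton
-- beside a layer adds 1.
odd-cycle : ∀ m → ARd-≤ (3 + m * 2) (2 * (3 + m * 2 + 2))
odd-cycle m = _ , ≤-refl , _ , blowup , maxDegree ends inner , λ c c-proper →
  rainbow-cycle c c-proper refl (chainEdges 1 (suc m) (0 ∷ [])) full (selected (layered c c-proper))
  where
  S : ℕ → ℕ
  S = oddSizes (suc m)

  S≤ : ∀ j → S j ≤ 2 + suc m * 4
  S≤ 0       = s≤s z≤n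
  S≤ (suc j) = chain-≤ 0 (suc m) j

  open Blowup (m * 2) (suc (suc m * 4)) S S≤ (chain-last 1 (suc m))

  slack : ∀ m → 1 + (2 + suc m * 4) + 3 ≡ 2 * (3 + m * 2 + 2)
  slack = solve-∀

  ends : S 1 + S (2 + m * 2) ≤ 2 * (3 + m * 2 + 2)
  ends = ≤-trans (+-mono-≤ (≤-refl {1}) (S≤ (2 + m * 2))) (≤-slack 3 (slack m))

  inner : ∀ j → 2 + j ≤ K → S j + S (2 + j) ≤ 2 * (3 + m * 2 + 2)
  inner 0       _ = ≤-trans (+-mono-≤ (≤-refl {1}) (S≤ 2)) (≤-slack 3 (slack m))
  inner (suc j) _ = ≤-trans (chain-+-≤ 0 (suc m) j) (≤-trans (n≤1+n _) (≤-slack 3 (slack m)))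

  full : ∀ {i} → i < K → i ∈ chainEdges 1 (suc m) (0 ∷ [])
  full {0}     _         = chainEdges-⊇ 1 (suc m) (here refl)
  full {suc i} (s≤s i<) = subst (_∈ chainEdges 1 (suc m) (0 ∷ [])) (+-comm i 1) (∈-chainEdges⁺ 1 (suc m) i i<)

  selected : ∀ {E} (L : LayeredColouring K S E) → Selection.Selected L (chainEdges 1 (suc m) (0 ∷ []))
  selected L = fill-chain 1 (suc m)
    (λ j → subst (λ i → chain 1 (suc m) j ≤ S i) (+-comm 1 j) ≤-refl)
    (≤-reflexive (+-comm (suc m * 2) 1))
    (λ { j _ (here eq) → contradiction (trans (+-comm 1 j) eq) λ () ; _ _ (there ()) })
    -- Only edge 0 is coloured at the start, so the zero selection is trivially rainbow.
    ((λ _ → 0) , (λ { 0 → s≤s z≤n ; (suc j) → 1≤chain 1 (suc m) j }) , λ { (here refl) (here refl) _ → refl ; (there ()) _ _ ; _ (there ()) _ })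
    where open Selection L

-- With k = 4 + 2m, the layers on either side of layer 2 give degree 1 + (4m + 5) = 2(k - 1), and
-- `chain-+-≤` at p = 1 yields the same number.
even-cycle : ∀ m → ARd-≤ (4 + m * 2) (2 * (3 + m * 2))
even-cycle m = _ , ≤-refl , _ , blowup , maxDegree ends inner , λ c c-proper →
  rainbow-cycle c c-proper refl edges full (selected (layered c c-proper))
  where
  S : ℕ → ℕ
  S = evenSizes m

  big : ∀ m → suc (m * 2 + 2 + (m * 2 + 2)) ≡ 5 + m * 4
  big = solve-∀

  S≤ : ∀ j → S j ≤ 5 + m * 4
  S≤ 0 = s≤s z≤n
  S≤ 1 = s≤s (s≤s z≤n)
  S≤ 2 = ≤-reflexive (big m)
  S≤ 3 = s≤s z≤n
  S≤ (suc (suc (suc (suc j)))) = ≤-trans (chain-≤ 1 m j) (n≤1+n _)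

  -- One better than `S≤`, which only layer 2 attains; `ends` needs this because layer 1 contributes
  -- 2.
  S[3+j]≤ : ∀ j → S (3 + j) ≤ 4 + m * 4
  S[3+j]≤ 0       = s≤s z≤n
  S[3+j]≤ (suc j) = chain-≤ 1 m j

  open Blowup (1 + m * 2) (4 + m * 4) S S≤ (chain-last 2 m)

  D≡ : ∀ m → 6 + m * 4 ≡ 2 * (3 + m * 2)
  D≡ = solve-∀

  ends : S 1 + S (3 + m * 2) ≤ 2 * (3 + m * 2)
  ends = ≤-trans (+-mono-≤ (≤-refl {2}) (S[3+j]≤ (m * 2))) (≤-reflexive (D≡ m))

  inner : ∀ j → 2 + j ≤ K → S j + S (2 + j) ≤ 2 * (3 + m * 2)
  inner j _ = ≤-trans (inner′ j) (≤-reflexive (D≡ m))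
    where
    inner′ : ∀ j → S j + S (2 + j) ≤ 6 + m * 4
    inner′ 0 = +-mono-≤ (≤-refl {1}) (S≤ 2)
    inner′ 1 = s≤s (s≤s (s≤s z≤n))
    inner′ 2 = ≤-trans (≤-reflexive (+-comm (S 2) 1)) (+-mono-≤ (≤-refl {1}) (S≤ 2))
    inner′ 3 = +-mono-≤ (≤-refl {1}) (S≤ 5)
    inner′ (suc (suc (suc (suc j)))) = chain-+-≤ 1 m j

  chained : List ℕ
  chained = chainEdges 4 m (0 ∷ 3 ∷ [])

  edges : List ℕ
  edges = 1 ∷ 2 ∷ chained

  full : ∀ {i} → i < K → i ∈ edges
  full {0} _ = there (there (chainEdges-⊇ 4 m (here refl)))
  full {1} _ = here refl
  full {2} _ = there (here refl)
  full {3} _ = there (there (chainEdges-⊇ 4 m (there (here refl))))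
  full {suc (suc (suc (suc i)))} (s≤s (s≤s (s≤s (s≤s i<)))) =
    there (there (subst (_∈ chained) (+-comm i 4) (∈-chainEdges⁺ 4 m i i<)))

  selected : ∀ {E} (L : LayeredColouring K S E) → Selection.Selected L edges
  selected {E} L = fill-layer 1 (s≤s (s≤s (s≤s z≤n))) 1∉ 2∉
    (subst (λ ℓ → width ℓ ≤ S 2) (≡-sym (length-chainEdges 4 m (0 ∷ 3 ∷ []))) ≤-refl)
    (fill-chain 4 m
      (λ j → subst (λ i → chain 2 m j ≤ S i) (+-comm 4 j) ≤-refl)
      (≤-reflexive (+-comm (m * 2) 4))
      (λ { j _ (here eq)         → contradiction (trans (+-comm 4 j) eq) λ ()
         ; j _ (there (here eq)) → contradiction (trans (+-comm 4 j) eq) λ ()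
         ; _ _ (there (there ())) })
      start)
    where
    open Selection L
    open LayeredColouring L

    1∉ : 1 ∉ chained
    1∉ p with ∈-chainEdges⁻ 4 m p
    ... | inj₁ (there (here ()))
    ... | inj₁ (there (there ()))
    ... | inj₂ (s≤s () , _)

    2∉ : 2 ∉ chained
    2∉ p with ∈-chainEdges⁻ 4 m p
    ... | inj₁ (there (here ()))
    ... | inj₁ (there (there ()))
    ... | inj₂ (s≤s (s≤s ()) , _)

    0<S : ∀ j → 0 < S j
    0<S 0 = s≤s z≤n
    0<S 1 = s≤s z≤n
    0<S 2 = s≤s z≤n
    0<S 3 = s≤s z≤n
    0<S (suc (suc (suc (suc j)))) = 1≤chain 2 m j

    two-edges : ∀ f → hue f 0 ≢ hue f 3 → RainbowOn (0 ∷ 3 ∷ []) f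
    two-edges f ne (here refl)         (here refl)         _  = refl
    two-edges f ne (here refl)         (there (here refl)) eq = contradiction eq ne
    two-edges f ne (there (here refl)) (here refl)         eq = contradiction (≡-sym eq) ne
    two-edges f ne (there (here refl)) (there (here refl)) _  = refl

    start : Selected (0 ∷ 3 ∷ [])
    start with E 0 0 0 ≟ E 3 0 0
    ... | no ne  = (λ _ → 0) , 0<S , two-edges _ ne
    -- Moving to the second vertex of layer 1 changes the colour of edge 0, by properness at layer
    -- 0, and does not touch edge 3.
    ... | yes eq = (λ _ → 0) [ 1 ↦ 1 ] , f< , two-edges ((λ _ → 0) [ 1 ↦ 1 ]) λ eq′ →
        contradiction (injectiveʳ {0} (s≤s (s≤s z≤n)) (s≤s z≤n) (s≤s z≤n) (s≤s (s≤s z≤n)) (trans eq (≡-sym eq′))) λ ()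
      where
      f< : ∀ j → ((λ _ → 0) [ 1 ↦ 1 ]) j < S j
      f< j with j ≟ 1
      ... | yes refl = s≤s (s≤s z≤n)
      ... | no _     = 0<S j

-- Parity of the cycle length

bound-odd : ∀ m → bound (3 + m * 2) ≡ 2 * (3 + m * 2 + 2)
bound-odd m rewrite [m+kn]%n≡m%n 1 (suc m) 2 {{_}} = refl

bound-even : ∀ m → bound (4 + m * 2) ≡ 2 * (3 + m * 2)
bound-even m rewrite [m+kn]%n≡m%n 0 (2 + m) 2 {{_}} = refl

odd⊎even : ∀ k → 3 ≤ k → (∃ λ m → k ≡ 3 + m * 2) ⊎ (∃ λ m → k ≡ 4 + m * 2)
odd⊎even 3 _ = inj₁ (0 , refl)
odd⊎even 4 _ = inj₂ (0 , refl)
odd⊎even (suc (suc (suc (suc (suc k))))) _ with odd⊎even (3 + k) (s≤s (s≤s (s≤s z≤n)))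
... | inj₁ (m , eq) = inj₁ (suc m , cong (2 +_) eq)
... | inj₂ (m , eq) = inj₂ (suc m , cong (2 +_) eq)
odd⊎even 1 (s≤s ())
odd⊎even 2 (s≤s (s≤s ()))

theorem1p4 : (k : ℕ) (h : 3 ≤ k) → ARd-≤ k {{>-nonZero (<-≤-trans (s≤s z≤n) h)}} (bound k)
theorem1p4 k h with odd⊎even k h
... | inj₁ (m , refl) = subst (ARd-≤ (3 + m * 2)) (≡-sym (bound-odd m)) (odd-cycle m)
... | inj₂ (m , refl) = subst (ARd-≤ (4 + m * 2)) (≡-sym (bound-even m)) (even-cycle m)
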